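{- For every integer $n \geq 5$, the Roman domination number of the generalized Petersen graph $P(n,2)$ is $\gamma_R(P(n,2)) = \left\lceil \frac{8n}{7} \right\rceil$.
   Context: For integers $n$ and $k$, the generalized Petersen graph $P(n,k)$ is the graph with vertex set $\{v_i, u_i : 0 \leq i \leq n-1\}$ and edge set $\{v_i v_{i+1}, v_i u_i, u_i u_{i+k} : 0 \leq i \leq n-1\}$, subscripts taken modulo $n$. A Roman domination function (RDF) on a graph $G$ is a function $f: V(G) \to \{0,1,2\}$ such that every vertex $u$ with $f(u)=0$ is adjacent to at least one vertex $v$ with $f(v)=2$. Its weight is $\sum_{u \in V(G)} f(u)$. The Roman domination number $\gamma_R(G)$ is the minimum weight of an RDF on $G$. -}

module Defs where

open import Data.Nat using (ℕ; suc; _+_; _*_; _≤_; NonZero)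
open import Data.Nat.DivMod using (_mod_; _/_)
open import Data.Fin using (Fin; toℕ)
open import Data.List using (List; map; allFin; _++_)
open import Data.Nat.ListAction using (sum)
open import Data.Product using (_×_; ∃)
open import Data.Sum using (_⊎_)
open import Relation.Binary.PropositionalEquality using (_≡_)

data Vertex (n : ℕ) : Set where
  v : Fin n → Vertex n
  u : Fin n → Vertex n

_⊕_ : {n : ℕ} .{{_ : NonZero n}} → Fin n → ℕ → Fin n
_⊕_ {n} i m = (toℕ i + m) mod n

data Edge (n k : ℕ) .{{_ : NonZero n}} : Vertex n → Vertex n → Set where
  outer : (i : Fin n) → Edge n k (v i) (v (i ⊕ 1))
  spoke : (i : Fin n) → Edge n k (v i) (u i)
  inner : (i : Fin n) → Edge n k (u i) (u (i ⊕ k))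

Adj : (n k : ℕ) .{{_ : NonZero n}} → Vertex n → Vertex n → Set
Adj n k x y = Edge n k x y ⊎ Edge n k y x

vertices : (n : ℕ) → List (Vertex n)
vertices n = map v (allFin n) ++ map u (allFin n)

IsRDF : (n k : ℕ) .{{_ : NonZero n}} → (Vertex n → Fin 3) → Set
IsRDF n k f = ∀ x → toℕ (f x) ≡ 0 → ∃ λ y → Adj n k x y × toℕ (f y) ≡ 2

weight : (n : ℕ) → (Vertex n → Fin 3) → ℕ
weight n f = sum (map (λ x → toℕ (f x)) (vertices n))

RomanDominationNumber≡ : (n k : ℕ) .{{_ : NonZero n}} → ℕ → Set
RomanDominationNumber≡ n k m =
  (∃ λ f → IsRDF n k f × weight n f ≡ m) ×
  (∀ f → IsRDF n k f → m ≤ weight n f)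

ceilDiv7 : ℕ → ℕ
ceilDiv7 a = (a + 6) / 7

{-# OPTIONS --safe #-}

-- Lower bound: read the columns (f(v_j), f(u_j)) around the cycle from right
-- to left, remembering only which vertices are already defended by what has
-- been read. This is a walk in a 27-state automaton, and a potential on the
-- states shows that each column of weight w satisfies 8 ≤ 7 w + (decrease of
-- the potential); the potential terms cancel around the cycle.
-- Upper bound: a block of 7 columns of weight 8 can be inserted repeatedly into
-- optimal functions for n = 6, …, 12; the case n = 5 is treated separately.
module Submission where

open import Defs
open import Data.Nat using (ℕ; zero; suc; pred; _+_; _*_; _≤_; _<_; z≤n; s≤s; s<s; s<s⁻¹; NonZero)
open import Data.Bool using (Bool; true; _∧_; T)
open import Data.Bool.Properties using (T-∧)
open import Data.Fin using (Fin; zero; suc; toℕ)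
open import Data.Fin.Patterns using (0F; 1F; 2F)
open import Data.Fin.Properties using (all?; fromℕ<-cong; fromℕ<-toℕ; toℕ-fromℕ<; toℕ<n)
import Data.Fin as Fin
open import Data.List using (List; []; _∷_; _++_; map; length; tabulate; applyUpTo; allFin)
open import Data.List.Properties using (length-++; map-++; map-tabulate)
open import Data.Nat.Divisibility using (divides)
open import Data.Nat.DivMod
open import Data.Nat.ListAction using (sum)
open import Data.Nat.ListAction.Properties using (sum-++)
open import Data.Nat.Properties
open import Algebra.Properties.CommutativeSemigroup +-commutativeSemigroup using (interchange; x∙yz≈y∙xz)
open import Data.Product using (_×_; _,_; proj₁; proj₂; ∃)
open import Data.Sum using (_⊎_; inj₁; inj₂)
open import Data.Unit using (tt)
open import Data.Vec using (Vec; []; _∷_; lookup)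
open import Function using (_∘_; id; Equivalence)
open import Relation.Binary.PropositionalEquality
open import Relation.Nullary using (Dec; isYes)
open import Relation.Nullary.Decidable using (_×-dec_; _⊎-dec_; _→-dec_; from-yes; toWitness)

-- Columns and the windows that test domination

Column : Set
Column = Fin 3 × Fin 3

cost : Column → ℕ
cost (a , b) = toℕ a + toℕ b

Defended : (x p q r : Fin 3) → Set
Defended x p q r = toℕ x ≡ 0 → toℕ p ≡ 2 ⊎ toℕ q ≡ 2 ⊎ toℕ r ≡ 2

defended? : ∀ x p q r → Dec (Defended x p q r)
defended? x p q r = (toℕ x ≟ 0) →-dec ((toℕ p ≟ 2) ⊎-dec ((toℕ q ≟ 2) ⊎-dec (toℕ r ≟ 2)))

-- Columns j, j+1, j+2 and j+4 contain the closed neighbourhoods of v_{j+1} and u_{j+2}.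
Window : (c₀ c₁ c₂ c₄ : Column) → Set
Window (a₀ , b₀) (a₁ , b₁) (a₂ , b₂) (a₄ , b₄) = Defended a₁ a₀ a₂ b₁ × Defended b₂ b₀ b₄ a₂

window? : ∀ c₀ c₁ c₂ c₄ → Dec (Window c₀ c₁ c₂ c₄)
window? (a₀ , b₀) (a₁ , b₁) (a₂ , b₂) (a₄ , b₄) = defended? a₁ a₀ a₂ b₁ ×-dec defended? b₂ b₀ b₄ a₂

-- Indices modulo `n`

+-cancelˡ-% : ∀ k a b n .{{_ : NonZero n}} → (k + a) % n ≡ (k + b) % n → a % n ≡ b % n
+-cancelˡ-% k a b n@(suc m) eq = begin
  a % n                              ≡⟨ expand a ⟩
  ((k + a) % n + (k * m) % n) % n    ≡⟨ cong (λ z → (z + (k * m) % n) % n) eq ⟩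
  ((k + b) % n + (k * m) % n) % n    ≡⟨ expand b ⟨
  b % n                              ∎
  where
  open ≡-Reasoning
  -- Adding `k * m` undoes adding `k`, since `k + k * m` is the multiple `k * n`.
  expand : ∀ c → c % n ≡ ((k + c) % n + (k * m) % n) % n
  expand c = begin
    c % n                            ≡⟨ [m+kn]%n≡m%n c k n ⟨
    (c + k * n) % n                  ≡⟨ cong (λ z → (c + z) % n) (*-suc k m) ⟩
    (c + (k + k * m)) % n            ≡⟨ cong (_% n) (trans (x∙yz≈y∙xz c k (k * m)) (sym (+-assoc k c (k * m)))) ⟩
    (k + c + k * m) % n              ≡⟨ %-distribˡ-+ (k + c) (k * m) n ⟩
    ((k + c) % n + (k * m) % n) % n  ∎

[k+m%n]%n≡[k+m]%n : ∀ k m n .{{_ : NonZero n}} → (k + m % n) % n ≡ (k + m) % n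
[k+m%n]%n≡[k+m]%n k m n = begin
  (k + m % n) % n          ≡⟨ %-distribˡ-+ k (m % n) n ⟩
  (k % n + m % n % n) % n  ≡⟨ cong (λ z → (k % n + z) % n) (m%n%n≡m%n m n) ⟩
  (k % n + m % n) % n      ≡⟨ %-distribˡ-+ k m n ⟨
  (k + m) % n              ∎
  where open ≡-Reasoning

module _ {n : ℕ} .{{_ : NonZero n}} where

  toℕ-mod : ∀ m → toℕ (m mod n) ≡ m % n
  toℕ-mod m = toℕ-fromℕ< (m%n<n m n)

  mod-cong : ∀ {a b} → a % n ≡ b % n → a mod n ≡ b mod n
  mod-cong {a} {b} eq = fromℕ<-cong (a % n) (b % n) eq (m%n<n a n) (m%n<n b n)

  mod-toℕ : ∀ i → toℕ i mod n ≡ i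
  mod-toℕ i = trans (fromℕ<-cong _ _ (m<n⇒m%n≡m (toℕ<n i)) (m%n<n (toℕ i) n) (toℕ<n i))
                    (fromℕ<-toℕ i (toℕ<n i))

  mod-⊕ : ∀ j k → (j mod n) ⊕ k ≡ (k + j) mod n
  mod-⊕ j k = mod-cong (begin
    (toℕ (j mod n) + k) % n  ≡⟨ cong (λ z → (z + k) % n) (toℕ-mod j) ⟩
    (j % n + k) % n          ≡⟨ cong (_% n) (+-comm (j % n) k) ⟩
    (k + j % n) % n          ≡⟨ [k+m%n]%n≡[k+m]%n k j n ⟩
    (k + j) % n              ∎)
    where open ≡-Reasoning

  ⊕-cancel-mod : ∀ i j k → i ⊕ k ≡ (k + j) mod n → i ≡ j mod n
  ⊕-cancel-mod i j k eq = trans (sym (mod-toℕ i)) (mod-cong (+-cancelˡ-% k (toℕ i) j n (begin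
    (k + toℕ i) % n          ≡⟨ cong (_% n) (+-comm k (toℕ i)) ⟩
    (toℕ i + k) % n          ≡⟨ toℕ-mod (toℕ i + k) ⟨
    toℕ (i ⊕ k)              ≡⟨ cong toℕ eq ⟩
    toℕ ((k + j) mod n)      ≡⟨ toℕ-mod (k + j) ⟩
    (k + j) % n              ∎)))
    where open ≡-Reasoning

  mod-shift-surjective : ∀ k i → ∃ λ j → (k + j) mod n ≡ i
  mod-shift-surjective k i = j , trans (mod-cong j-shift) (mod-toℕ i)
    where
    open ≡-Reasoning
    -- `k * pred n` represents the negative of `k` modulo `n`.
    j = toℕ i + k * pred n
    j-shift : (k + j) % n ≡ toℕ i % n
    j-shift = begin
      (k + (toℕ i + k * pred n)) % n    ≡⟨ cong (_% n) (x∙yz≈y∙xz k (toℕ i) _) ⟩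
      (toℕ i + (k + k * pred n)) % n    ≡⟨ cong (λ z → (toℕ i + z) % n) (*-suc k _) ⟨
      (toℕ i + k * suc (pred n)) % n    ≡⟨ cong (λ z → (toℕ i + k * z) % n) (suc-pred n) ⟩
      (toℕ i + k * n) % n                        ≡⟨ [m+kn]%n≡m%n (toℕ i) k n ⟩
      toℕ i % n                                  ∎

  -- Roman domination as a condition on cyclic windows

  column : (Vertex n → Fin 3) → ℕ → Column
  column f j = f (v (j mod n)) , f (u (j mod n))

  column-cong : ∀ f {a b} → a % n ≡ b % n → column f a ≡ column f b
  column-cong f eq = cong (λ i → f (v i) , f (u i)) (mod-cong eq)

  CyclicWindows : (ℕ → Column) → Set
  CyclicWindows C = ∀ j → Window (C j) (C (1 + j)) (C (2 + j)) (C (4 + j))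

  IsRDF⇒windows : ∀ {f} → IsRDF n 2 f → CyclicWindows (column f)
  IsRDF⇒windows {f} rdf j = outer-defended , inner-defended
    where
    V U : ℕ → Fin 3
    V m = f (v (m mod n))
    U m = f (u (m mod n))

    -- The index `i` is general and tied down by an equation: matching on a backward edge would
    -- otherwise have to unify `i ⊕ 1` with `(1 + j) mod n`.
    v-neighbour : ∀ {i y} → Adj n 2 (v i) y → i ≡ (1 + j) mod n → toℕ (f y) ≡ 2 →
                  toℕ (V j) ≡ 2 ⊎ toℕ (V (2 + j)) ≡ 2 ⊎ toℕ (U (1 + j)) ≡ 2
    v-neighbour (inj₁ (outer _)) refl two =
      inj₂ (inj₁ (subst (λ i → toℕ (f (v i)) ≡ 2) (mod-⊕ (1 + j) 1) two))
    v-neighbour (inj₁ (spoke _)) refl two = inj₂ (inj₂ two)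
    v-neighbour (inj₂ (outer i)) eq two =
      inj₁ (subst (λ i → toℕ (f (v i)) ≡ 2) (⊕-cancel-mod i j 1 eq) two)

    u-neighbour : ∀ {i y} → Adj n 2 (u i) y → i ≡ (2 + j) mod n → toℕ (f y) ≡ 2 →
                  toℕ (U j) ≡ 2 ⊎ toℕ (U (4 + j)) ≡ 2 ⊎ toℕ (V (2 + j)) ≡ 2
    u-neighbour (inj₁ (inner _)) refl two =
      inj₂ (inj₁ (subst (λ i → toℕ (f (u i)) ≡ 2) (mod-⊕ (2 + j) 2) two))
    u-neighbour (inj₂ (spoke _)) refl two = inj₂ (inj₂ two)
    u-neighbour (inj₂ (inner i)) eq two =
      inj₁ (subst (λ i → toℕ (f (u i)) ≡ 2) (⊕-cancel-mod i j 2 eq) two)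

    outer-defended : Defended (V (1 + j)) (V j) (V (2 + j)) (U (1 + j))
    outer-defended fx≡0 = let _ , adj , two = rdf _ fx≡0 in v-neighbour adj refl two

    inner-defended : Defended (U (2 + j)) (U j) (U (4 + j)) (V (2 + j))
    inner-defended fx≡0 = let _ , adj , two = rdf _ fx≡0 in u-neighbour adj refl two

  outer-mod : ∀ j → Edge n 2 (v (j mod n)) (v ((1 + j) mod n))
  outer-mod j = subst (Edge n 2 (v (j mod n)) ∘ v) (mod-⊕ j 1) (outer (j mod n))

  inner-mod : ∀ j → Edge n 2 (u (j mod n)) (u ((2 + j) mod n))
  inner-mod j = subst (Edge n 2 (u (j mod n)) ∘ u) (mod-⊕ j 2) (inner (j mod n))

  windows⇒IsRDF : ∀ {f} → CyclicWindows (column f) → IsRDF n 2 f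
  windows⇒IsRDF win (v i) fx≡0 with mod-shift-surjective 1 i
  ... | j , refl with proj₁ (win j) fx≡0
  ... | inj₁ two = v (j mod n) , inj₂ (outer-mod j) , two
  ... | inj₂ (inj₁ two) = v ((2 + j) mod n) , inj₁ (outer-mod (1 + j)) , two
  ... | inj₂ (inj₂ two) = u ((1 + j) mod n) , inj₁ (spoke _) , two
  windows⇒IsRDF win (u i) fx≡0 with mod-shift-surjective 2 i
  ... | j , refl with proj₂ (win j) fx≡0
  ... | inj₁ two = u (j mod n) , inj₂ (inner-mod j) , two
  ... | inj₂ (inj₁ two) = u ((4 + j) mod n) , inj₁ (inner-mod (2 + j)) , two
  ... | inj₂ (inj₂ two) = v ((2 + j) mod n) , inj₂ (spoke _) , two

-- The weight as a sum over columns

sum-tabulate-+ : ∀ {n} (F G : Fin n → ℕ) (h : ℕ → ℕ) → (∀ i → F i + G i ≡ h (toℕ i)) →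
                 sum (tabulate F) + sum (tabulate G) ≡ sum (applyUpTo h n)
sum-tabulate-+ {zero}  F G h eq = refl
sum-tabulate-+ {suc n} F G h eq =
  trans (interchange (F zero) (sum (tabulate (F ∘ suc))) (G zero) (sum (tabulate (G ∘ suc))))
        (cong₂ _+_ (eq zero) (sum-tabulate-+ (F ∘ suc) (G ∘ suc) (h ∘ suc) (eq ∘ suc)))

-- `h` is arbitrary because the columns come from `column f` in the lower bound and from a list in
-- the upper bound.
weight-by-columns : ∀ n f (h : ℕ → ℕ) → (∀ i → cost (f (v i) , f (u i)) ≡ h (toℕ i)) →
                    weight n f ≡ sum (applyUpTo h n)
weight-by-columns n f h eq = begin
  sum (map g (map v (allFin n) ++ map u (allFin n)))
    ≡⟨ cong sum (map-++ g (map v (allFin n)) _) ⟩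
  sum (map g (map v (allFin n)) ++ map g (map u (allFin n)))
    ≡⟨ sum-++ (map g (map v (allFin n))) _ ⟩
  sum (map g (map v (allFin n))) + sum (map g (map u (allFin n)))
    ≡⟨ cong₂ (λ xs ys → sum xs + sum ys) (tabulated v) (tabulated u) ⟩
  sum (tabulate (g ∘ v)) + sum (tabulate (g ∘ u))
    ≡⟨ sum-tabulate-+ (g ∘ v) (g ∘ u) h eq ⟩
  sum (applyUpTo h n) ∎
  where
  open ≡-Reasoning
  g : Vertex n → ℕ
  g x = toℕ (f x)
  tabulated : (w : Fin n → Vertex n) → map g (map w (allFin n)) ≡ tabulate (g ∘ w)
  tabulated w = trans (cong (map g) (map-tabulate id w)) (map-tabulate w g)

-- Lower bound

-- Value x of a vertex two of whose neighbours have values p and q, where an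
-- undefended 0 is kept and a defended 0 becomes 1.
status : (x p q : Fin 3) → Fin 3
status zero    2F _  = 1F
status zero    _  2F = 1F
status zero    _  _  = 0F
status (suc x) _  _  = suc x

-- `status` only asks whether a neighbour is 2, and replacing a value by its status neither creates
-- nor removes a 2. Hence the automaton can store statuses in place of values.
status-idem : ∀ x p r s q → status x (status p r s) q ≡ status x p q
status-idem = from-yes (all? λ x → all? λ p → all? λ r → all? λ s → all? λ q →
  status x (status p r s) q Fin.≟ status x p q)

-- Used with `p` the leftmost neighbour, the last one read: a 0 that the others leave undefended
-- must be defended by it.
undefended⇒2 : ∀ x p q r → Defended x p q r → toℕ (status x q r) ≡ 0 → toℕ p ≡ 2
undefended⇒2 = from-yes (all? λ x → all? λ p → all? λ q → all? λ r →
  defended? x p q r →-dec ((toℕ (status x q r) ≟ 0) →-dec (toℕ p ≟ 2)))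

-- Arguments: the statuses of v_j, u_j and u_{j+1}. The entries are shortest-path
-- distances in the automaton, an arc of weight w having length 7 w - 8.
potential : Fin 3 → Fin 3 → Fin 3 → ℕ
potential x y z = lookup (lookup (lookup table x) y) z
  where
  table : Vec (Vec (Vec ℕ 3) 3) 3
  table = (( 0 ∷  7 ∷ 11 ∷ []) ∷ ( 7 ∷ 10 ∷ 11 ∷ []) ∷ (26 ∷ 26 ∷ 26 ∷ []) ∷ [])
        ∷ (( 7 ∷  8 ∷ 18 ∷ []) ∷ (14 ∷ 15 ∷ 18 ∷ []) ∷ (13 ∷ 19 ∷ 19 ∷ []) ∷ [])
        ∷ ((26 ∷ 26 ∷ 26 ∷ []) ∷ (13 ∷ 16 ∷ 25 ∷ []) ∷ (20 ∷ 26 ∷ 26 ∷ []) ∷ [])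
        ∷ []

-- A finite check. `x`, `y`, `z` are the statuses of v_{j+1}, u_{j+1}, u_{j+2}, and column j is
-- `(a , b)`. It holds the last neighbours of the first and third, so a 0 there forces a 2; `y`
-- waits one more step, as inner edges span two columns.
potential-step : ∀ x y z a b → (toℕ x ≡ 0 → toℕ a ≡ 2) → (toℕ z ≡ 0 → toℕ b ≡ 2) →
                 8 + potential (status a x b) (status b z a) y ≤ 7 * cost (a , b) + potential x y z
potential-step = from-yes (all? λ x → all? λ y → all? λ z → all? λ a → all? λ b →
  ((toℕ x ≟ 0) →-dec (toℕ a ≟ 2)) →-dec (((toℕ z ≟ 0) →-dec (toℕ b ≟ 2)) →-dec
  (8 + potential (status a x b) (status b z a) y ≤? 7 * cost (a , b) + potential x y z)))

-- The potential stays on both sides because it may rise or fall, and subtraction on ℕ would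
-- truncate.
telescope : ∀ c k (w φ : ℕ → ℕ) → (∀ j → c + φ j ≤ k * w j + φ (suc j)) →
            ∀ n → c * n + φ 0 ≤ k * sum (applyUpTo w n) + φ n
telescope c k w φ step zero    = ≤-reflexive (cong (_+ φ 0) (trans (*-zeroʳ c) (sym (*-zeroʳ k))))
telescope c k w φ step (suc n) = begin
  c * suc n + φ 0              ≡⟨ cong (_+ φ 0) (trans (*-suc c n) (+-comm c (c * n))) ⟩
  c * n + c + φ 0              ≡⟨ +-assoc (c * n) c (φ 0) ⟩
  c * n + (c + φ 0)            ≤⟨ +-monoʳ-≤ (c * n) (step 0) ⟩
  c * n + (k * w 0 + φ 1)      ≡⟨ x∙yz≈y∙xz (c * n) (k * w 0) (φ 1) ⟩
  k * w 0 + (c * n + φ 1)      ≤⟨ +-monoʳ-≤ (k * w 0) (telescope c k (w ∘ suc) (φ ∘ suc) (step ∘ suc) n) ⟩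
  k * w 0 + (k * W + φ (suc n)) ≡⟨ +-assoc (k * w 0) (k * W) (φ (suc n)) ⟨
  k * w 0 + k * W + φ (suc n)   ≡⟨ cong (_+ φ (suc n)) (*-distribˡ-+ k (w 0) W) ⟨
  k * (w 0 + W) + φ (suc n)     ∎
  where
  open ≤-Reasoning
  W = sum (applyUpTo (w ∘ suc) n)

8n≤7weight : ∀ n .{{_ : NonZero n}} f → IsRDF n 2 f → 8 * n ≤ 7 * weight n f
8n≤7weight n f rdf = +-cancelʳ-≤ (Φ 0) _ _ (begin
  8 * n + Φ 0                                   ≤⟨ telescope 8 7 (cost ∘ C) Φ Φ-step n ⟩
  7 * sum (applyUpTo (cost ∘ C) n) + Φ n        ≡⟨ cong₂ (λ x y → 7 * x + y) weight≡ Φ-periodic ⟨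
  7 * weight n f + Φ 0                          ∎)
  where
  open ≤-Reasoning
  C : ℕ → Column
  C = column f

  V U statusV statusU : ℕ → Fin 3
  V j = proj₁ (C j)
  U j = proj₂ (C j)
  statusV j = status (V j) (V (1 + j)) (U j)
  statusU j = status (U j) (U (2 + j)) (V j)
  Φ : ℕ → ℕ
  Φ j = potential (statusV j) (statusU j) (statusU (1 + j))

  Φ-step : ∀ j → 8 + Φ j ≤ 7 * cost (C j) + Φ (suc j)
  -- `potential-step` gives the new state in terms of stored statuses; `status-idem` identifies it
  -- with the state computed from values.
  Φ-step j = subst₂ (λ x y → 8 + potential x y (statusU (1 + j)) ≤ 7 * cost (C j) + Φ (suc j))
    (status-idem (V j) (V (1 + j)) (V (2 + j)) (U (1 + j)) (U j))
    (status-idem (U j) (U (2 + j)) (U (4 + j)) (V (2 + j)) (V j))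
    (potential-step (statusV (1 + j)) (statusU (1 + j)) (statusU (2 + j)) (V j) (U j)
      (undefended⇒2 (V (1 + j)) (V j) (V (2 + j)) (U (1 + j)) (proj₁ win))
      (undefended⇒2 (U (2 + j)) (U j) (U (4 + j)) (V (2 + j)) (proj₂ win)))
    where win = IsRDF⇒windows rdf j

  C-periodic : ∀ k → C k ≡ C (k + n)
  C-periodic k = column-cong f (sym ([m+n]%n≡m%n k n))

  Φ-periodic : Φ 0 ≡ Φ n
  Φ-periodic = cong₂ (λ x (y , z) → potential x y z)
    (cong₂ (λ c d → status (proj₁ c) (proj₁ d) (proj₂ c)) (C-periodic 0) (C-periodic 1))
    (cong₂ _,_ (statusU-periodic 0) (statusU-periodic 1))
    where
    statusU-periodic : ∀ k → statusU k ≡ statusU (k + n)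
    statusU-periodic k = cong₂ (λ c d → status (proj₂ c) (proj₂ d) (proj₁ c)) (C-periodic k) (C-periodic (2 + k))

  weight≡ : weight n f ≡ sum (applyUpTo (cost ∘ C) n)
  weight≡ = weight-by-columns n f (cost ∘ C)
    λ i → cong (λ i′ → cost (f (v i′) , f (u i′))) (sym (mod-toℕ i))

-- The bound gives `m + 6 < suc k * 7`, so the quotient stays below `suc k`.
ceilDiv7-least : ∀ m k → m ≤ 7 * k → ceilDiv7 m ≤ k
ceilDiv7-least m k m≤7k = ≤-pred (m<n*o⇒m/o<n (begin-strict
  m + 6      ≤⟨ +-monoˡ-≤ 6 m≤7k ⟩
  7 * k + 6  ≡⟨ +-comm (7 * k) 6 ⟩
  6 + 7 * k  <⟨ n<1+n _ ⟩
  7 + 7 * k  ≡⟨ cong (7 +_) (*-comm 7 k) ⟩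
  suc k * 7  ∎))
  where open ≤-Reasoning

-- Upper bound

-- Beyond the end of the list the value is junk.
at : List Column → ℕ → Column
at []       _       = 0F , 0F
at (c ∷ cs) zero    = c
at (c ∷ cs) (suc i) = at cs i

at-++ˡ : ∀ cs ds {i} → i < length cs → at (cs ++ ds) i ≡ at cs i
at-++ˡ (c ∷ cs) ds {zero}  _   = refl
at-++ˡ (c ∷ cs) ds {suc i} i<n = at-++ˡ cs ds (s<s⁻¹ i<n)

at-++ʳ : ∀ cs ds i → at (cs ++ ds) (i + length cs) ≡ at ds i
at-++ʳ []       ds i = cong (at ds) (+-identityʳ i)
at-++ʳ (c ∷ cs) ds i = trans (cong (at (c ∷ cs ++ ds)) (+-suc i (length cs))) (at-++ʳ cs ds i)

total : List Column → ℕ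
total = sum ∘ map cost

sum-at : ∀ cs → sum (applyUpTo (cost ∘ at cs) (length cs)) ≡ total cs
sum-at []       = refl
sum-at (c ∷ cs) = cong (cost c +_) (sum-at cs)

-- Boolean, so that it computes on a concrete prefix of an unknown list.
good : List Column → Bool
good (c₀ ∷ cs@(c₁ ∷ c₂ ∷ _ ∷ c₄ ∷ _)) = isYes (window? c₀ c₁ c₂ c₄) ∧ good cs
good _ = true

good⇒window : ∀ cs j → T (good cs) → 4 + j < length cs →
              Window (at cs j) (at cs (1 + j)) (at cs (2 + j)) (at cs (4 + j))
good⇒window (c₀ ∷ cs@(c₁ ∷ c₂ ∷ _ ∷ c₄ ∷ _)) zero    ok _ =
  toWitness {a? = window? c₀ c₁ c₂ c₄} (proj₁ (Equivalence.to T-∧ ok))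
good⇒window (c₀ ∷ cs@(c₁ ∷ c₂ ∷ _ ∷ c₄ ∷ _)) (suc j) ok j< =
  good⇒window cs j (proj₂ (Equivalence.to (T-∧ {isYes (window? c₀ c₁ c₂ c₄)}) ok)) (s<s⁻¹ j<)
good⇒window [] _ _ ()
good⇒window (_ ∷ []) _ _ (s<s ())
good⇒window (_ ∷ _ ∷ []) _ _ (s<s (s<s ()))
good⇒window (_ ∷ _ ∷ _ ∷ []) _ _ (s<s (s<s (s<s ())))
good⇒window (_ ∷ _ ∷ _ ∷ _ ∷ []) _ _ (s<s (s<s (s<s (s<s ()))))

AchievesWeight : (n : ℕ) .{{_ : NonZero n}} → ℕ → Set
AchievesWeight n m = ∃ λ f → IsRDF n 2 f × weight n f ≡ m

-- Appending the first four columns makes every cyclic window a window of the list.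
good⇒RDF : ∀ n .{{_ : NonZero n}} h cs → length h ≡ 4 → length (h ++ cs) ≡ n →
           T (good ((h ++ cs) ++ h)) → AchievesWeight n (total (h ++ cs))
good⇒RDF n h cs |h|≡4 refl ok = f , windows⇒IsRDF windows , trans weight≡ (sum-at w)
  where
  w = h ++ cs

  f : Vertex n → Fin 3
  f (v i) = proj₁ (at w (toℕ i))
  f (u i) = proj₂ (at w (toℕ i))

  weight≡ : weight n f ≡ sum (applyUpTo (cost ∘ at w) n)
  weight≡ = weight-by-columns n f (cost ∘ at w) λ _ → refl

  at-cyclic : ∀ k r → k ≤ 4 → r < n → at (w ++ h) (k + r) ≡ at w ((k + r) % n)
  at-cyclic k r k≤4 r<n with <-≤-connex (k + r) n
  ... | inj₁ k+r<n = trans (at-++ˡ w h k+r<n) (cong (at w) (sym (m<n⇒m%n≡m k+r<n)))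
  ... | inj₂ n≤k+r with m≤n⇒∃[o]m+o≡n n≤k+r
  -- The overflow `i` is below `k ≤ 4`, so the appended `h` and the `h` that begins `w` agree there.
  ... | i , n+i≡k+r = begin
    at (w ++ h) (k + r)   ≡⟨ cong (at (w ++ h)) (trans (sym n+i≡k+r) (+-comm n i)) ⟩
    at (w ++ h) (i + n)   ≡⟨ at-++ʳ w h i ⟩
    at h i                ≡⟨ at-++ˡ h cs i<|h| ⟨
    at w i                ≡⟨ cong (at w) (m<n⇒m%n≡m i<n) ⟨
    at w (i % n)          ≡⟨ cong (at w) ([m+n]%n≡m%n i n) ⟨
    at w ((i + n) % n)    ≡⟨ cong (λ z → at w (z % n)) (trans (+-comm i n) n+i≡k+r) ⟩
    at w ((k + r) % n)    ∎
    where
    open ≡-Reasoning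
    i<|h| : i < length h
    i<|h| = <-≤-trans
      (+-cancelˡ-< n i k (subst₂ _<_ (sym n+i≡k+r) (+-comm k n) (+-monoʳ-< k r<n)))
      (≤-trans k≤4 (≤-reflexive (sym |h|≡4)))
    i<n : i < n
    i<n = <-≤-trans i<|h| (subst (length h ≤_) (sym (length-++ h)) (m≤m+n (length h) (length cs)))

  column-at : ∀ k j → k ≤ 4 → at (w ++ h) (k + j % n) ≡ column f (k + j)
  column-at k j k≤4 = begin
    at (w ++ h) (k + j % n)       ≡⟨ at-cyclic k (j % n) k≤4 (m%n<n j n) ⟩
    at w ((k + j % n) % n)        ≡⟨ cong (at w) ([k+m%n]%n≡[k+m]%n k j n) ⟩
    at w ((k + j) % n)            ≡⟨ cong (at w) (toℕ-mod (k + j)) ⟨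
    at w (toℕ ((k + j) mod n))    ∎
    where open ≡-Reasoning

  windows : CyclicWindows (column f)
  -- Once `j` is reduced modulo `n`, no position wraps around in `w ++ h`: the last is
  -- `4 + j % n < 4 + n`.
  windows j
    rewrite sym (column-at 0 j z≤n) | sym (column-at 1 j (s≤s z≤n))
          | sym (column-at 2 j (s≤s (s≤s z≤n))) | sym (column-at 4 j ≤-refl)
    = good⇒window (w ++ h) (j % n) ok (subst (4 + j % n <_) |w++h| (+-monoʳ-< 4 (m%n<n j n)))
    where
    |w++h| : 4 + n ≡ length (w ++ h)
    |w++h| = trans (+-comm 4 n) (trans (cong (n +_) (sym |h|≡4)) (sym (length-++ w)))

-- A window reaches at most four columns past its first. As every list for `n ≥ 6` begins with these
-- four, a block can be put in front of any of them, and the windows across the seam are always the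
-- same.
head : List Column
head = (0F , 0F) ∷ (1F , 0F) ∷ (0F , 2F) ∷ (0F , 2F) ∷ []

-- head ++ tail m has 6 + m columns; the first seven entries were found by computer
-- search, and head ++ (1,0) ∷ (0,0) ∷ (2,0) ∷ [] is the block of weight 8.
tail : ℕ → List Column
tail 0 = (0F , 0F) ∷ (2F , 0F) ∷ []
tail 1 = (1F , 0F) ∷ (0F , 0F) ∷ (2F , 0F) ∷ []
tail 2 = (1F , 0F) ∷ (0F , 0F) ∷ (2F , 0F) ∷ (2F , 0F) ∷ []
tail 3 = (1F , 0F) ∷ (0F , 0F) ∷ (2F , 0F) ∷ (0F , 1F) ∷ (2F , 0F) ∷ []
tail 4 = (1F , 0F) ∷ (0F , 0F) ∷ (2F , 0F) ∷ (0F , 1F) ∷ (0F , 1F) ∷ (2F , 0F) ∷ []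
tail 5 = (0F , 0F) ∷ (2F , 0F) ∷ (0F , 0F) ∷ (0F , 2F) ∷ (0F , 2F) ∷ (0F , 0F) ∷ (2F , 0F) ∷ []
tail 6 = (0F , 0F) ∷ (2F , 0F) ∷ (0F , 0F) ∷ (1F , 0F) ∷ (0F , 2F) ∷ (0F , 2F) ∷ (0F , 0F) ∷ (2F , 0F) ∷ []
tail (suc (suc (suc (suc (suc (suc (suc m))))))) =
  (1F , 0F) ∷ (0F , 0F) ∷ (2F , 0F) ∷ head ++ tail m

length-tail : ∀ m → length (tail m) ≡ 2 + m
length-tail 0 = refl
length-tail 1 = refl
length-tail 2 = refl
length-tail 3 = refl
length-tail 4 = refl
length-tail 5 = refl
length-tail 6 = refl
length-tail (suc (suc (suc (suc (suc (suc (suc m))))))) = cong (7 +_) (length-tail m)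

good-tail : ∀ m → T (good ((head ++ tail m) ++ head))
good-tail 0 = tt
good-tail 1 = tt
good-tail 2 = tt
good-tail 3 = tt
good-tail 4 = tt
good-tail 5 = tt
good-tail 6 = tt
-- The seven windows starting in the inserted block meet only it and the `head` after it, so their
-- tests compute to `true` and vanish.
good-tail (suc (suc (suc (suc (suc (suc (suc m))))))) = good-tail m

ceilDiv7-8[7+n] : ∀ n → ceilDiv7 (8 * (7 + n)) ≡ 8 + ceilDiv7 (8 * n)
ceilDiv7-8[7+n] n = begin
  (8 * (7 + n) + 6) / 7   ≡⟨ cong (λ z → (z + 6) / 7) (*-distribˡ-+ 8 7 n) ⟩
  (56 + 8 * n + 6) / 7    ≡⟨ cong (_/ 7) (+-assoc 56 (8 * n) 6) ⟩
  (56 + (8 * n + 6)) / 7  ≡⟨ +-distrib-/-∣ˡ {56} (8 * n + 6) {7} (divides 8 refl) ⟩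
  8 + (8 * n + 6) / 7     ∎
  where open ≡-Reasoning

total-tail : ∀ m → total (head ++ tail m) ≡ ceilDiv7 (8 * (6 + m))
total-tail 0 = refl
total-tail 1 = refl
total-tail 2 = refl
total-tail 3 = refl
total-tail 4 = refl
total-tail 5 = refl
total-tail 6 = refl
total-tail (suc (suc (suc (suc (suc (suc (suc m))))))) =
  trans (cong (8 +_) (total-tail m)) (sym (ceilDiv7-8[7+n] (6 + m)))

weight-⌈8n/7⌉-achieved : ∀ n .{{_ : NonZero n}} → 5 ≤ n → AchievesWeight n (ceilDiv7 (8 * n))
-- `head` fails here: it weighs 5 of the 6 allowed, yet v_0 would need a 2 in the one remaining
-- column.
weight-⌈8n/7⌉-achieved 5 _ =
  good⇒RDF 5 ((0F , 0F) ∷ (0F , 2F) ∷ (0F , 2F) ∷ (0F , 0F) ∷ []) ((2F , 0F) ∷ []) refl refl tt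
weight-⌈8n/7⌉-achieved (suc (suc (suc (suc (suc (suc m)))))) _ =
  subst (AchievesWeight (6 + m)) (total-tail m)
    (good⇒RDF (6 + m) head (tail m) refl (cong (4 +_) (length-tail m)) (good-tail m))
weight-⌈8n/7⌉-achieved 1 (s≤s ())
weight-⌈8n/7⌉-achieved 2 (s≤s (s≤s ()))
weight-⌈8n/7⌉-achieved 3 (s≤s (s≤s (s≤s ())))
weight-⌈8n/7⌉-achieved 4 (s≤s (s≤s (s≤s (s≤s ()))))

theorem2p12 : (n : ℕ) .{{_ : NonZero n}} → 5 ≤ n → RomanDominationNumber≡ n 2 (ceilDiv7 (8 * n))
theorem2p12 n 5≤n =
  weight-⌈8n/7⌉-achieved n 5≤n ,
  λ f rdf → ceilDiv7-least (8 * n) (weight n f) (8n≤7weight n f rdf)
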